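{- Let $b,n\geq 2$ be integers, let $a=\frac{b^n-1}{b-1}$, let $d\in\mathbb{P}$ with $\gcd(a,d)=1$, and let $$A=\left(a,\ ba+d,\ b^2a+\tfrac{b^2-1}{b-1}d,\ \dots,\ b^{n-1}a+\tfrac{b^{n-1}-1}{b-1}d\right).$$ Then the type of $\langle A\rangle$ is $t(A)=n-1$, and $$PF(A)=\{F(A),\ F(A)-d,\ \dots,\ F(A)-(n-2)d\}.$$
   Context: $\mathbb{P}$ denotes the positive integers. $\langle A\rangle$ is the numerical semigroup of all nonnegative integer combinations of entries of $A$; $F(A)$ is the largest integer not in $\langle A\rangle$. An integer $u\notin\langle A\rangle$ is a pseudo-Frobenius number if $u+s\in\langle A\rangle$ for all $s\in\langle A\rangle\setminus\{0\}$; $PF(A)$ is the set of pseudo-Frobenius numbers and the type $t(A)$ is its cardinality. -}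

module Defs where

open import Level using (0ℓ)
open import Data.Fin using (toℕ)
open import Data.Integer as ℤ using (ℤ; +_; 0ℤ)
open import Data.List using (length)
import Data.List.Membership.Propositional as List
open import Data.List.Relation.Unary.Unique.Propositional using (Unique)
open import Data.Nat using (ℕ; suc; _+_; _*_; _∸_; _^_; _/_; NonZero; NonTrivial)
open import Data.Product using (_×_; ∃-syntax)
open import Data.Vec using (Vec; sum; tabulate; zipWith)
open import Relation.Binary.PropositionalEquality using (_≡_; _≢_)
open import Relation.Unary using (Pred; _∈_; _∉_; _≐_)

-- The semigroup is taken as a subset of ℤ because the Frobenius and
-- pseudo-Frobenius numbers range over all integers.
⟨_⟩ : ∀ {k} → Vec ℕ k → Pred ℤ 0ℓ
⟨_⟩ A x = ∃[ c ] x ≡ + sum (zipWith _*_ c A)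

IsFrobenius : ∀ {k} → Vec ℕ k → Pred ℤ 0ℓ
IsFrobenius A f = f ∉ ⟨ A ⟩ × (∀ x → x ∉ ⟨ A ⟩ → x ℤ.≤ f)

PF : ∀ {k} → Vec ℕ k → Pred ℤ 0ℓ
PF A u = u ∉ ⟨ A ⟩ × (∀ s → s ∈ ⟨ A ⟩ → s ≢ 0ℤ → u ℤ.+ s ∈ ⟨ A ⟩)

-- A repetition-free enumeration is used instead of a bijection with
-- Σ ℤ P, since membership proofs need not be unique.
HasCardinality : Pred ℤ 0ℓ → ℕ → Set
HasCardinality P m =
  ∃[ xs ] Unique xs × length xs ≡ m × (List._∈ xs) ≐ P

HasType : ∀ {k} → Vec ℕ k → ℕ → Set
HasType A t = HasCardinality (PF A) t

pred-nonZero : ∀ b .{{_ : NonTrivial b}} → NonZero (b ∸ 1)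
pred-nonZero (suc (suc _)) = _

-- The division is exact, and both truncated subtractions are genuine
-- because b ≥ 2.
repunit : (b k : ℕ) .{{_ : NonTrivial b}} → ℕ
repunit b k = _/_ (b ^ k ∸ 1) (b ∸ 1) {{pred-nonZero b}}

-- The entry at i = 0 is b⁰a + 0·d, i.e. a itself.
generators : (b n d : ℕ) .{{_ : NonTrivial b}} → Vec ℕ n
generators b n d =
  tabulate λ i → b ^ toℕ i * repunit b n + repunit b (toℕ i) * d

{-# OPTIONS --safe #-}
module Submission where

-- Write c = b - 1, r_i = (b^i - 1)/c and D = c a + d, so that the generators are
-- a + r_i D. Hence l a + m D lies in the semigroup as soon as m is a sum of at most
-- l coins r_1, …, r_{n-1}, and D is invertible modulo a. Put
--   f_i = (i + 1) c a + (a - 1 - i) D = f_0 - i d.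
-- For i ≤ n - 2, f_i is not in the semigroup: a representation of it would write
-- b^n - 1 as a sum of (i + 1) c < n c powers of b, while its digit sum is n c.
-- Still, f_i plus any generator lies in the semigroup. Finally, every integer x
-- outside the semigroup has f_i - x inside it for some i ≤ n - 2, by complementing
-- the greedy payment of the residue of x. So the f_i are exactly the
-- pseudo-Frobenius numbers, and f_0 is the largest gap.

open import Defs
open import Algebra using (AbelianGroup)
import Algebra.Properties.Group as Group
open import Data.Fin as Fin using (Fin; toℕ; fromℕ<)
open import Data.Fin.Properties using (toℕ-fromℕ<; toℕ<n)
open import Data.Integer as ℤ using (ℤ; +_; -[1+_]; _-_)
open import Data.Integer.DivMod using (_%ℕ_; _/ℕ_; a≡a%ℕn+[a/ℕn]*n; n%ℕd<d)
import Data.Integer.Properties as ℤₚ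
import Data.Integer.Tactic.RingSolver as ℤ-Solver
open import Data.List using (map; upTo)
import Data.List.Membership.Propositional as List
open import Data.List.Membership.Propositional.Properties using (∈-map⁺; ∈-map⁻; ∈-upTo⁺; ∈-upTo⁻)
open import Data.List.Properties using (length-map; length-upTo)
import Data.List.Relation.Unary.Unique.Propositional.Properties as Unique
open import Data.Nat using (ℕ; zero; suc; _+_; _*_; _∸_; _^_; _≤_; _<_; z≤n; s≤s; s≤s⁻¹; NonZero; NonTrivial)
open import Data.Nat.Coprimality using (Coprime; coprime-divisor; coprime-Bézout; gcd≡1⇒coprime)
open import Data.Nat.Divisibility using (_∣_; divides; ∣m+n∣m⇒∣n; ∣⇒≤; ∣n⇒∣m*n; m∣m*n; n∣m*n)
open import Data.Nat.DivMod using (_/_; _%_; m≡m%n+[m/n]*n; m%n<n; m*n/n≡m)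
open import Data.Nat.GCD using (gcd; module Bézout)
open import Data.Nat.Properties
open import Data.Nat.Tactic.RingSolver using (solve-∀)
open import Data.Product using (_×_; _,_; ∃-syntax; proj₁; proj₂)
open import Data.Sum using (_⊎_; inj₁; inj₂)
open import Data.Vec using (Vec; []; _∷_; lookup; replicate; sum; tabulate; zipWith)
open import Data.Vec.Properties using (lookup∘tabulate; tabulate-cong)
open import Function using (_∘_)
open import Relation.Binary.Definitions using (tri<; tri≈; tri>)
open import Relation.Binary.PropositionalEquality
open import Relation.Nullary using (Dec; yes; no; contradiction)
open import Relation.Unary using (_∈_; _∉_; _≐_)

private module ℤ-Group = Group (AbelianGroup.group ℤₚ.+-0-abelianGroup)

-- Natural-number combinations of the entries of a vector.

dot : ∀ {k} → Vec ℕ k → Vec ℕ k → ℕ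
dot cs v = sum (zipWith _*_ cs v)

dot-zero : ∀ {k} (v : Vec ℕ k) → dot (replicate k 0) v ≡ 0
dot-zero []      = refl
dot-zero (_ ∷ v) = dot-zero v

dot-distribʳ-+ : ∀ {k} (cs es v : Vec ℕ k) → dot (zipWith _+_ cs es) v ≡ dot cs v + dot es v
dot-distribʳ-+ []       []       []      = refl
dot-distribʳ-+ (c ∷ cs) (e ∷ es) (x ∷ v) =
  trans (cong (_+_ ((c + e) * x)) (dot-distribʳ-+ cs es v)) (interchange c e x (dot cs v) (dot es v))
  where
  interchange : ∀ c e x s t → (c + e) * x + (s + t) ≡ c * x + s + (e * x + t)
  interchange = solve-∀

dot-unit : ∀ {k} (v : Vec ℕ k) (i : Fin k) → ∃[ cs ] dot cs v ≡ lookup v i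
dot-unit (x ∷ v) Fin.zero =
  1 ∷ replicate _ 0 , trans (cong (_+_ (1 * x)) (dot-zero v)) (trans (+-identityʳ (1 * x)) (*-identityˡ x))
dot-unit (x ∷ v) (Fin.suc i) with cs , eq ← dot-unit v i = 0 ∷ cs , eq

dot-split : ∀ {k} (cs v : Vec ℕ k) →
            dot cs v ≡ 0 ⊎ ∃[ i ] ∃[ es ] dot cs v ≡ lookup v i + dot es v
dot-split [] [] = inj₁ refl
dot-split (suc c ∷ cs) (x ∷ v) = inj₂ (Fin.zero , c ∷ cs , +-assoc x (c * x) (dot cs v))
dot-split (zero ∷ cs) (x ∷ v) with dot-split cs v
... | inj₁ eq            = inj₁ eq
... | inj₂ (i , es , eq) = inj₂ (Fin.suc i , 0 ∷ es , eq)

-- With `f` constantly 1 and `g` the repunits, this reads off the coin count and the amount of a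
-- combination.
dot-linear : ∀ {k} (cs : Vec ℕ k) (f g : Fin k → ℕ) x y →
             dot cs (tabulate λ i → f i * x + g i * y)
             ≡ dot cs (tabulate f) * x + dot cs (tabulate g) * y
dot-linear []       f g x y = refl
dot-linear (c ∷ cs) f g x y =
  trans (cong (_+_ (c * (f Fin.zero * x + g Fin.zero * y))) (dot-linear cs (f ∘ Fin.suc) (g ∘ Fin.suc) x y))
        (regroup c (f Fin.zero) (g Fin.zero) x y _ _)
  where
  regroup : ∀ c p q x y s t →
            c * (p * x + q * y) + (s * x + t * y) ≡ (c * p + s) * x + (c * q + t) * y
  regroup = solve-∀

-- Elements of the generated semigroup.

module _ {k} (A : Vec ℕ k) where

  0∈⟨⟩ : + 0 ∈ ⟨ A ⟩
  0∈⟨⟩ = replicate k 0 , cong +_ (sym (dot-zero A))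

  +∈⟨⟩ : ∀ {x y} → x ∈ ⟨ A ⟩ → y ∈ ⟨ A ⟩ → x ℤ.+ y ∈ ⟨ A ⟩
  +∈⟨⟩ (cs , refl) (es , refl) = zipWith _+_ cs es , cong +_ (sym (dot-distribʳ-+ cs es A))

  generator∈⟨⟩ : ∀ i → + lookup A i ∈ ⟨ A ⟩
  generator∈⟨⟩ i with cs , eq ← dot-unit A i = cs , cong +_ (sym eq)

  -- A nonzero element is a generator plus another element, so only the generators need testing.
  PF-from-generators : ∀ {u} → u ∉ ⟨ A ⟩ → (∀ i → u ℤ.+ + lookup A i ∈ ⟨ A ⟩) → u ∈ PF A
  PF-from-generators {u} u∉ step = u∉ , absorb
    where
    absorb : ∀ s → s ∈ ⟨ A ⟩ → s ≢ ℤ.0ℤ → u ℤ.+ s ∈ ⟨ A ⟩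
    absorb s (cs , refl) s≢0 with dot-split cs A
    ... | inj₁ eq            = contradiction (cong +_ eq) s≢0
    ... | inj₂ (i , es , eq) =
      subst (_∈ ⟨ A ⟩)
            (trans (ℤₚ.+-assoc u (+ lookup A i) (+ dot es A)) (cong (λ t → u ℤ.+ + t) (sym eq)))
            (+∈⟨⟩ (step i) (es , refl))

-- Repunits and digit sums.

-- The repunit `1 + b + ... + b^(k-1)` in Horner form, free of division.
geom : ℕ → ℕ → ℕ
geom b zero    = 0
geom b (suc k) = suc (b * geom b k)

^≡1+pred*geom : ∀ c k → suc c ^ k ≡ suc (c * geom (suc c) k)
^≡1+pred*geom c zero    = cong suc (sym (*-zeroʳ c))
^≡1+pred*geom c (suc k) = trans (cong (suc c *_) (^≡1+pred*geom c k)) (regroup c (geom (suc c) k))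
  where
  regroup : ∀ c g → suc c * suc (c * g) ≡ suc (c * suc (suc c * g))
  regroup = solve-∀

repunit≡geom : ∀ γ k → repunit (suc (suc γ)) k ≡ geom (suc (suc γ)) k
repunit≡geom γ k =
  trans (cong (λ p → (p ∸ 1) / suc γ) (^≡1+pred*geom (suc γ) k))
        (trans (cong (_/ suc γ) (*-comm (suc γ) g)) (m*n/n≡m g (suc γ)))
  where
  g = geom (suc (suc γ)) k

k≤geom : ∀ c k → k ≤ geom (suc c) k
k≤geom c zero    = z≤n
k≤geom c (suc k) = s≤s (≤-trans (k≤geom c k) (m≤n*m (geom (suc c) k) (suc c)))

geom-mono-≤ : ∀ c {j k} → j ≤ k → geom (suc c) j ≤ geom (suc c) k
geom-mono-≤ c z≤n       = z≤n
geom-mono-≤ c (s≤s j≤k) = s≤s (*-monoʳ-≤ (suc c) (geom-mono-≤ c j≤k))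

-- t is the carry into the lowest digit; dividing by the base turns t + e, where
-- e is that digit, into the next carry, and t + e ≡ -1 modulo the base.
digit-sum-≥ : ∀ c {k} (es : Vec ℕ k) t →
              suc (t + dot es (tabulate λ i → suc c ^ toℕ i)) ≡ suc c ^ k →
              k * c ≤ t + dot es (tabulate λ _ → 1)
digit-sum-≥ c [] t _ = z≤n
digit-sum-≥ c {suc k} (e ∷ es) t eq = finish b∣
  where
  b = suc c
  X = dot es (tabulate λ i → b ^ toℕ i)
  Σes = dot es (tabulate λ _ → 1)

  shift : dot es (tabulate λ i → b * b ^ toℕ i) ≡ b * X
  shift = trans (cong (dot es) (tabulate-cong λ i → pad b (b ^ toℕ i)))
         (trans (dot-linear es (λ i → b ^ toℕ i) (λ _ → 0) b 0)
                (unpad X b (dot es (tabulate λ _ → 0))))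
    where
    pad : ∀ b p → b * p ≡ p * b + 0 * 0
    pad = solve-∀
    unpad : ∀ X b z → X * b + z * 0 ≡ b * X
    unpad = solve-∀

  total : b * X + suc (t + e) ≡ b * b ^ k
  total = trans (regroup b X t e) (trans (cong (λ y → suc (t + (e * 1 + y))) (sym shift)) eq)
    where
    regroup : ∀ b X t e → b * X + suc (t + e) ≡ suc (t + (e * 1 + b * X))
    regroup = solve-∀

  b∣ : b ∣ suc (t + e)
  b∣ = ∣m+n∣m⇒∣n (subst (b ∣_) (sym total) (m∣m*n (b ^ k))) (m∣m*n X)

  finish : b ∣ suc (t + e) → suc k * c ≤ t + (e * 1 + Σes)
  -- The quotient is positive since `suc (t + e)` is; the carry is one less, so the new total is
  -- again one short of a power.
  finish (divides (suc q) te) = begin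
    c + k * c             ≤⟨ +-monoʳ-≤ c (digit-sum-≥ c es q next) ⟩
    c + (q + Σes)         ≤⟨ m≤m+n _ (q * c) ⟩
    c + (q + Σes) + q * c ≡⟨ regroup c q Σes ⟩
    c + q * b + Σes       ≡⟨ cong (_+ Σes) (sym (suc-injective te)) ⟩
    t + e + Σes           ≡⟨ reassociate t e Σes ⟩
    t + (e * 1 + Σes)     ∎
    where
    open ≤-Reasoning
    regroup : ∀ c q s → c + (q + s) + q * c ≡ c + q * suc c + s
    regroup = solve-∀
    reassociate : ∀ t e s → t + e + s ≡ t + (e * 1 + s)
    reassociate = solve-∀
    collect : ∀ b X q → b * suc (q + X) ≡ b * X + suc q * b
    collect = solve-∀
    next : suc (q + X) ≡ b ^ k
    next = *-cancelˡ-≡ _ _ b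
      (trans (collect b X q) (trans (cong (_+_ (b * X)) (sym te)) total))

-- Paying amounts with repunit coins.

-- The worthless coin geom b 0 = 0 accounts for the generator a.
data Change (b n : ℕ) : ℕ → ℕ → Set where
  none : Change b n 0 0
  coin : ∀ {i l m} → i < n → Change b n l m → Change b n (suc l) (geom b i + m)

module _ {b n : ℕ} where

  coins : ∀ {i l m} q → i < n → Change b n l m → Change b n (q + l) (q * geom b i + m)
  coins zero    i<n ch = ch
  coins {i} {m = m} (suc q) i<n ch =
    subst (Change b n _) (sym (+-assoc (geom b i) (q * geom b i) m)) (coin i<n (coins q i<n ch))

  -- The missing coins are filled in by the one of index 0, worth nothing.
  pad-coins : ∀ {l l′ m} → 0 < n → l ≤ l′ → Change b n l m → Change b n l′ m
  pad-coins {l} {l′} {m} 0<n l≤l′ ch =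
    subst₂ (Change b n) (m∸n+n≡m l≤l′) (cong (_+ m) (*-zeroʳ (l′ ∸ l))) (coins (l′ ∸ l) 0<n ch)

  unit-coins : ∀ {m} → 1 < n → Change b n m m
  unit-coins {m} 1<n =
    subst₂ (Change b n) (+-identityʳ m) (units b m) (coins m 1<n none)
    where
    units : ∀ b m → m * suc (b * 0) + 0 ≡ m
    units = solve-∀

weaken : ∀ {b n l m} → Change b n l m → Change b (suc n) l m
weaken none          = none
weaken (coin i<n ch) = coin (m<n⇒m<1+n i<n) (weaken ch)

-- The greedy payment of m stops at a coin of multiplicity at most b with no
-- smaller coin used, and has multiplicity at most c = b - 1 above it; it is
-- completed to multiplicities b and c exactly, which pays geom b n - 1 - i.
complementary-change :
  ∀ c ν m → m < geom (suc c) (2 + ν) →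
  ∃[ i ] ∃[ l ] ∃[ l′ ] ∃[ m′ ]
    i ≤ ν × suc (i + (m + m′)) ≡ geom (suc c) (2 + ν) × l + l′ ≡ suc (suc i * c)
    × Change (suc c) (2 + ν) l m × Change (suc c) (2 + ν) l′ m′
complementary-change c zero m m<g =
  -- Here `a = b + 1`, so `m ≤ b`, and units pay both `m` and `b - m`.
  0 , m , suc c ∸ m , suc c ∸ m , z≤n
    , trans (cong suc (m+[n∸m]≡n m≤b)) (unit c)
    , trans (m+[n∸m]≡n m≤b) (cong suc (sym (+-identityʳ c)))
    , unit-coins ≤-refl , unit-coins ≤-refl
  where
  unit : ∀ c → suc (suc c) ≡ suc (suc c * suc (suc c * 0))
  unit = solve-∀
  m≤b : m ≤ suc c
  m≤b = s≤s⁻¹ (subst (m <_) (sym (unit c)) m<g)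
complementary-change c (suc ν) m m<g with m ≟ suc c * geom (suc c) (2 + ν)
-- The largest amount: `b` top coins, already complete, so nothing remains to be paid.
... | yes refl =
  0 , suc c , 0 , 0 , z≤n , cong suc (+-identityʳ _) , refl
    , subst₂ (Change (suc c) (3 + ν)) (+-identityʳ (suc c)) (+-identityʳ _) (coins (suc c) ≤-refl none)
    , none
... | no m≢ with i , l , l′ , m′ , i≤ν , sum-m , sum-l , ch , ch′
                 ← complementary-change c ν (m % geom (suc c) (2 + ν)) (m%n<n m (geom (suc c) (2 + ν))) =
  -- The `q` top coins are completed to `c` by `e = c - q` more; the remainder is left to the
  -- smaller coins.
  suc i , q + l , e + l′ , e * g + m′ , s≤s i≤ν
    , trans (cong (λ x → suc (suc i + (x + (e * g + m′)))) (m≡m%n+[m/n]*n m g))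
     (trans (regroup i (m % g) q g e m′) (cong₂ (λ x y → suc (x + y * g)) sum-m q+e≡c))
    , trans (interchange q l e l′) (trans (cong₂ _+_ q+e≡c sum-l) (+-suc c _))
    , subst (Change (suc c) (3 + ν) _) (trans (+-comm (q * g) (m % g)) (sym (m≡m%n+[m/n]*n m g)))
            (coins q ≤-refl (weaken ch))
    , coins e ≤-refl (weaken ch′)
  where
  g = geom (suc c) (2 + ν)
  q = m / g
  q≤c : q ≤ c
  q≤c with q ≤? c
  ... | yes p = p
  -- Were `q` at least `b`, then `m` would be the excluded amount `b * g`.
  ... | no ¬p = contradiction (≤-antisym (s≤s⁻¹ m<g) bg≤m) m≢
    where
    bg≤m : suc c * g ≤ m
    bg≤m = ≤-trans (*-monoˡ-≤ g (≰⇒> ¬p))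
             (≤-trans (m≤n+m (q * g) (m % g)) (≤-reflexive (sym (m≡m%n+[m/n]*n m g))))
  e = c ∸ q
  q+e≡c : q + e ≡ c
  q+e≡c = m+[n∸m]≡n q≤c
  regroup : ∀ i r q g e m′ → suc (suc i + ((r + q * g) + (e * g + m′))) ≡ suc (suc (i + (r + m′)) + (q + e) * g)
  regroup = solve-∀
  interchange : ∀ q l e l′ → (q + l) + (e + l′) ≡ (q + e) + (l + l′)
  interchange = solve-∀

-- Take `c` copies of each of the `i` largest coins and `b` of the next one. As
-- `geom b (k+1) = 1 + b * geom b k`, trading one coin for `b` of the next smaller kind loses
-- exactly one unit.
top-change :
  ∀ c ν i → i ≤ ν →
  ∃[ m ] i + m ≡ suc c * geom (suc c) (suc ν) × Change (suc c) (2 + ν) (suc (suc i * c)) m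
top-change c ν zero _ =
  suc c * geom (suc c) (suc ν) , refl
    , subst (Change (suc c) (2 + ν) _) (+-identityʳ _) (coins (suc c) ≤-refl none)
top-change c (suc ν) (suc i) (s≤s i≤ν) with m , eq , ch ← top-change c ν i i≤ν =
  c * g + m
    , trans (regroup i (c * g) m) (cong (λ x → suc x + c * g) eq)
    , subst (λ l → Change (suc c) (3 + ν) l (c * g + m)) (+-suc c _) (coins c ≤-refl (weaken ch))
  where
  g = geom (suc c) (2 + ν)
  regroup : ∀ i x m → suc i + (x + m) ≡ suc (i + m) + x
  regroup = solve-∀

-- Coefficients with respect to coprime `a` and `D`.

-- Coprimality makes `a` divide the difference of `m` and `M`. If `M < m`, this contradicts `m < a`;
-- if `m < M`, then `M - m ≥ a` forces `l ≥ D`.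
coprime-coefficients-unique :
  ∀ {a D K M l m} → Coprime a D → m < a → l < D →
  K * a + M * D ≡ l * a + m * D → K ≡ l × M ≡ m
coprime-coefficients-unique {a@(suc _)} {D} {K} {M} {l} {m} a⊥D m<a l<D eq with <-cmp M m
... | tri≈ _ refl _ = *-cancelʳ-≡ K l a (+-cancelʳ-≡ (M * D) (K * a) (l * a) eq) , refl
... | tri< M<m _ _ with e , refl ← m≤n⇒∃[o]m+o≡n M<m = contradiction m<a (≤⇒≯ a≤m)
  where
  Ka : l * a + D * suc e ≡ K * a
  Ka = +-cancelʳ-≡ (M * D) _ _ (trans (regroup (l * a) D e M) (sym eq))
    where
    regroup : ∀ x D e M → x + D * suc e + M * D ≡ x + (suc M + e) * D
    regroup = solve-∀
  a≤m : a ≤ suc M + e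
  a≤m = ≤-trans (∣⇒≤ (coprime-divisor a⊥D (∣m+n∣m⇒∣n (divides K Ka) (n∣m*n l)))) (s≤s (m≤n+m e M))
... | tri> _ _ m<M with e , refl ← m≤n⇒∃[o]m+o≡n m<M = contradiction l<D (≤⇒≯ D≤l)
  where
  la : K * a + D * suc e ≡ l * a
  la = +-cancelʳ-≡ (m * D) _ _ (trans (regroup (K * a) D e m) eq)
    where
    regroup : ∀ x D e M → x + D * suc e + M * D ≡ x + (suc M + e) * D
    regroup = solve-∀
  a≤e : a ≤ suc e
  a≤e = ∣⇒≤ (coprime-divisor a⊥D (∣m+n∣m⇒∣n (divides l la) (n∣m*n K)))
  D≤l : D ≤ l
  D≤l = *-cancelʳ-≤ D l a (begin
    D * a             ≤⟨ *-monoʳ-≤ D a≤e ⟩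
    D * suc e         ≤⟨ m≤n+m (D * suc e) (K * a) ⟩
    K * a + D * suc e ≡⟨ la ⟩
    l * a             ∎)
    where open ≤-Reasoning

pos-lin : ∀ k a m D → + (k * a + m * D) ≡ + k ℤ.* + a ℤ.+ + m ℤ.* + D
pos-lin k a m D = trans (ℤₚ.pos-+ (k * a) (m * D)) (cong₂ ℤ._+_ (ℤₚ.pos-* k a) (ℤₚ.pos-* m D))

ℤ-bézout : ∀ {a D} → Coprime a D → ∃[ u ] ∃[ v ] u ℤ.* + a ℤ.+ v ℤ.* + D ≡ + 1
ℤ-bézout {a} {D} a⊥D with coprime-Bézout a⊥D
... | Bézout.+- x y eq = + x , ℤ.- + y , trans (cong (ℤ._+ (ℤ.- + y) ℤ.* + D) xa) (cancel (+ y) (+ D))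
  where
  xa : + x ℤ.* + a ≡ + 1 ℤ.+ + y ℤ.* + D
  xa = trans (sym (ℤₚ.pos-* x a)) (trans (cong +_ (sym eq)) (cong (ℤ._+_ (+ 1)) (ℤₚ.pos-* y D)))
  cancel : ∀ y D → + 1 ℤ.+ y ℤ.* D ℤ.+ (ℤ.- y) ℤ.* D ≡ + 1
  cancel = ℤ-Solver.solve-∀
... | Bézout.-+ x y eq = ℤ.- + x , + y , trans (cong (ℤ._+_ ((ℤ.- + x) ℤ.* + a)) yD) (cancel (+ x) (+ a))
  where
  yD : + y ℤ.* + D ≡ + 1 ℤ.+ + x ℤ.* + a
  yD = trans (sym (ℤₚ.pos-* y D)) (trans (cong +_ (sym eq)) (cong (ℤ._+_ (+ 1)) (ℤₚ.pos-* x a)))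
  cancel : ∀ x a → (ℤ.- x) ℤ.* a ℤ.+ (+ 1 ℤ.+ x ℤ.* a) ≡ + 1
  cancel = ℤ-Solver.solve-∀

-- Multiply Bézout's identity by `x`, reduce the coefficient of `D` modulo `a` and move the quotient
-- into that of `a`.
coprime-coefficients : ∀ {a D} .{{_ : NonZero a}} → Coprime a D →
                       ∀ x → ∃[ k ] ∃[ m ] m < a × x ≡ k ℤ.* + a ℤ.+ + m ℤ.* + D
coprime-coefficients {a} {D} a⊥D x with u , v , uv ← ℤ-bézout a⊥D =
  q ℤ.* + D ℤ.+ x ℤ.* u , y %ℕ a , n%ℕd<d y a , (begin
    x                                                    ≡⟨ sym (ℤₚ.*-identityʳ x) ⟩
    x ℤ.* + 1                                            ≡⟨ cong (ℤ._*_ x) (sym uv) ⟩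
    x ℤ.* (u ℤ.* + a ℤ.+ v ℤ.* + D)                      ≡⟨ expand x u v (+ a) (+ D) ⟩
    x ℤ.* u ℤ.* + a ℤ.+ y ℤ.* + D                        ≡⟨ cong (λ z → x ℤ.* u ℤ.* + a ℤ.+ z ℤ.* + D) (a≡a%ℕn+[a/ℕn]*n y a) ⟩
    x ℤ.* u ℤ.* + a ℤ.+ (+ (y %ℕ a) ℤ.+ q ℤ.* + a) ℤ.* + D ≡⟨ regroup (x ℤ.* u) (+ a) (+ (y %ℕ a)) q (+ D) ⟩
    (q ℤ.* + D ℤ.+ x ℤ.* u) ℤ.* + a ℤ.+ + (y %ℕ a) ℤ.* + D ∎)
  where
  open ≡-Reasoning
  y = x ℤ.* v
  q = y /ℕ a
  expand : ∀ x u v a D → x ℤ.* (u ℤ.* a ℤ.+ v ℤ.* D) ≡ x ℤ.* u ℤ.* a ℤ.+ x ℤ.* v ℤ.* D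
  expand = ℤ-Solver.solve-∀
  regroup : ∀ w a r q D → w ℤ.* a ℤ.+ (r ℤ.+ q ℤ.* a) ℤ.* D ≡ (q ℤ.* D ℤ.+ w) ℤ.* a ℤ.+ r ℤ.* D
  regroup = ℤ-Solver.solve-∀

compare-pos : ∀ k l → (∃[ e ] k ≡ + (e + l)) ⊎ (∃[ e ] k ≡ + l - + suc e)
compare-pos k l with k - + l in eq
... | + e      = inj₁ (e , trans (restore k (+ l)) (cong (ℤ._+ + l) eq))
  where
  restore : ∀ k l → k ≡ k - l ℤ.+ l
  restore = ℤ-Solver.solve-∀
... | -[1+ e ] = inj₂ (e , trans (restore k (+ l)) (cong (ℤ._+_ (+ l)) eq))
  where
  restore : ∀ k l → k ≡ l ℤ.+ (k - l)
  restore = ℤ-Solver.solve-∀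

-- From `l + l′ = suc L`, the coefficient `L - (l - suc e)` is `e + l′`: the extra coin offsets the
-- shortfall of at least one.
subtract-payment :
  ∀ l l′ m m′ e a D {L M x} → l + l′ ≡ suc L → m + m′ ≡ M →
  x ≡ (+ l - + suc e) ℤ.* + a ℤ.+ + m ℤ.* + D →
  + ((e + l′) * a + m′ * D) ≡ + (L * a + M * D) - x
subtract-payment l l′ m m′ e a D {L} sum-l refl refl =
  trans (pos-lin (e + l′) a m′ D)
 (trans (regroup (+ l) (+ l′) (+ m) (+ m′) (+ e) (+ a) (+ D))
        (cong (_- ((+ l - + suc e) ℤ.* + a ℤ.+ + m ℤ.* + D))
              (trans (cong (λ p → (+ p - + 1) ℤ.* + a ℤ.+ + (m + m′) ℤ.* + D) sum-l)
                     (sym (pos-lin L a (m + m′) D)))))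
  where
  regroup : ∀ l l′ m m′ e a D →
    (e ℤ.+ l′) ℤ.* a ℤ.+ m′ ℤ.* D
    ≡ (l ℤ.+ l′ - + 1) ℤ.* a ℤ.+ (m ℤ.+ m′) ℤ.* D - ((l - (+ 1 ℤ.+ e)) ℤ.* a ℤ.+ m ℤ.* D)
  regroup = ℤ-Solver.solve-∀

-- Here `m + g = a + e`, and `a` copies of `D` are exchanged for `D` copies of `a`.
overflow : ∀ l D m i e {a g} → suc (m + i) ≡ a → suc i + e ≡ g →
           (l + D) * a + e * D ≡ l * a + (m + g) * D
overflow l D m i e refl refl = spread l D m i e
  where
  spread : ∀ l D m i e → (l + D) * suc (m + i) + e * D ≡ l * suc (m + i) + (m + (suc i + e)) * D
  spread = solve-∀

-- The semigroup generated by the numbers `a + r_i D`.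

module RepunitSemigroup
  (γ ν d a′ : ℕ) (geom≡a : geom (2 + γ) (2 + ν) ≡ suc a′) (a⊥d : Coprime (suc a′) d)
  (A : Vec ℕ (2 + ν))
  (A≡ : A ≡ tabulate λ i → 1 * suc a′ + geom (2 + γ) (toℕ i) * (suc γ * suc a′ + d))
  where

  c b n a D : ℕ
  c = suc γ
  b = suc c
  n = 2 + ν
  a = suc a′
  D = c * a + d

  S = ⟨ A ⟩

  ν<a′ : ν < a′
  ν<a′ = s≤s⁻¹ (subst (n ≤_) geom≡a (k≤geom c n))

  a≤D : a ≤ D
  a≤D = ≤-trans (m≤n*m a c) (m≤m+n (c * a) d)

  a⊥D : Coprime a D
  a⊥D (k∣a , k∣D) = a⊥d (k∣a , ∣m+n∣m⇒∣n k∣D (∣n⇒∣m*n c k∣a))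

  lookup-A : ∀ i → lookup A i ≡ 1 * a + geom b (toℕ i) * D
  lookup-A i = trans (cong (λ v → lookup v i) A≡) (lookup∘tabulate (λ j → 1 * a + geom b (toℕ j) * D) i)

  dot-A : ∀ cs → dot cs A ≡ dot cs (tabulate λ _ → 1) * a + dot cs (tabulate λ i → geom b (toℕ i)) * D
  dot-A cs = trans (cong (dot cs) A≡) (dot-linear cs (λ _ → 1) (λ i → geom b (toℕ i)) a D)

  change⇒∈ : ∀ {l m} → Change b n l m → + (l * a + m * D) ∈ S
  change⇒∈ none = 0∈⟨⟩ A
  change⇒∈ (coin {i} {l} {m} i<n ch) =
    subst (_∈ S) (cong +_ eq) (+∈⟨⟩ A (generator∈⟨⟩ A (fromℕ< i<n)) (change⇒∈ ch))
    where
    regroup : ∀ g l m a D → 1 * a + g * D + (l * a + m * D) ≡ suc l * a + (g + m) * D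
    regroup = solve-∀
    eq : lookup A (fromℕ< i<n) + (l * a + m * D) ≡ suc l * a + (geom b i + m) * D
    eq = trans (cong (_+ (l * a + m * D))
                     (trans (lookup-A (fromℕ< i<n)) (cong (λ j → 1 * a + geom b j * D) (toℕ-fromℕ< i<n))))
               (regroup (geom b i) l m a D)

  f : ℕ → ℕ
  f i = suc i * c * a + (a′ ∸ i) * D

  f+i*d≡f0 : ∀ {i} → i ≤ ν → f i + i * d ≡ f 0
  f+i*d≡f0 {i} i≤ν = trans (regroup i c a (a′ ∸ i) d)
    (cong (λ m → 1 * c * a + m * D) (m∸n+n≡m (≤-trans i≤ν (<⇒≤ ν<a′))))
    where
    regroup : ∀ i c a m d → suc i * c * a + m * (c * a + d) + i * d ≡ 1 * c * a + (m + i) * (c * a + d)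
    regroup = solve-∀

  f≡f0-i*d : ∀ {i} → i ≤ ν → + f i ≡ + f 0 - + (i * d)
  f≡f0-i*d {i} i≤ν = trans (cancel (+ f i) (+ (i * d))) (cong (λ z → + z - + (i * d)) (f+i*d≡f0 i≤ν))
    where
    cancel : ∀ x y → x ≡ x ℤ.+ y - y
    cancel = ℤ-Solver.solve-∀

  -- The bounds `m<a` and `l<D` fix the coin count `K` and the amount `M` of any representation. As
  -- `b ^ j = 1 + c * geom b j`, the corresponding powers sum to
  -- `K + M * c = c * a - 0 = b ^ n - 1`, which takes at least `n * c` of them.
  f∉S : ∀ {i} → i ≤ ν → + f i ∉ S
  f∉S {i} i≤ν (cs , eq) = contradiction (*-cancelʳ-≤ n (suc i) c n*c≤) (<⇒≱ (s≤s (s≤s i≤ν)))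
    where
    K = dot cs (tabulate λ _ → 1)
    M = dot cs (tabulate λ i → geom b (toℕ i))
    m<a : a′ ∸ i < a
    m<a = s≤s (m∸n≤m a′ i)
    l<D : suc i * c < D
    l<D = ≤-trans (*-monoˡ-< c (s≤s (≤-<-trans i≤ν ν<a′))) (≤-trans (≤-reflexive (*-comm a c)) (m≤m+n (c * a) d))
    coefficients : K ≡ suc i * c × M ≡ a′ ∸ i
    coefficients = coprime-coefficients-unique a⊥D m<a l<D (trans (sym (dot-A cs)) (sym (ℤₚ.+-injective eq)))
    pow : dot cs (tabulate λ i → b ^ toℕ i) ≡ K * 1 + M * c
    pow = trans (cong (dot cs) (tabulate-cong λ i → trans (^≡1+pred*geom c (toℕ i)) (cong suc (*-comm c _))))
                (dot-linear cs (λ _ → 1) (λ i → geom b (toℕ i)) 1 c)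
    digits : suc (dot cs (tabulate λ i → b ^ toℕ i)) ≡ b ^ n
    digits = begin
      suc (dot cs (tabulate λ i → b ^ toℕ i)) ≡⟨ cong suc pow ⟩
      suc (K * 1 + M * c)                     ≡⟨ cong₂ (λ k m → suc (k * 1 + m * c)) (proj₁ coefficients) (proj₂ coefficients) ⟩
      suc (suc i * c * 1 + (a′ ∸ i) * c)      ≡⟨ regroup i c (a′ ∸ i) ⟩
      suc (c * suc (a′ ∸ i + i))              ≡⟨ cong (λ m → suc (c * suc m)) (m∸n+n≡m (≤-trans i≤ν (<⇒≤ ν<a′))) ⟩
      suc (c * a)                             ≡⟨ sym (trans (^≡1+pred*geom c n) (cong (λ x → suc (c * x)) geom≡a)) ⟩
      b ^ n                                   ∎
      where
      open ≡-Reasoning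
      regroup : ∀ i c m → suc (suc i * c * 1 + m * c) ≡ suc (c * suc (m + i))
      regroup = solve-∀
    n*c≤ : n * c ≤ suc i * c
    n*c≤ = subst (n * c ≤_) (proj₁ coefficients) (digit-sum-≥ c cs 0 digits)

  top∈ : ∀ {i} → i ≤ ν → Change b n (suc (suc i * c)) (a′ ∸ i)
  top∈ {i} i≤ν with m , eq , ch ← top-change c ν i i≤ν =
    subst (Change b n _) (trans (sym (m+n∸m≡n i m)) (cong (_∸ i) (trans eq (suc-injective geom≡a)))) ch

  -- Either the new coin g turns the payment of a - 1 - i into one of
  -- a - 1 - (i - g), or the amount reaches a, and a D is worth D coins.
  f+generator∈S : ∀ {i} → i ≤ ν → ∀ j → + f i ℤ.+ + lookup A j ∈ S
  f+generator∈S {i} i≤ν j =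
    subst (_∈ S) (cong +_ (trans (regroup (suc i * c) a m D g) (cong (_+_ (f i)) (sym (lookup-A j)))))
          (value (g ≤? i))
    where
    g = geom b (toℕ j)
    m = a′ ∸ i
    i≤a′ : i ≤ a′
    i≤a′ = ≤-trans i≤ν (<⇒≤ ν<a′)
    regroup : ∀ l a m D g → suc l * a + (m + g) * D ≡ l * a + m * D + (1 * a + g * D)
    regroup = solve-∀
    value : Dec (g ≤ i) → + (suc (suc i * c) * a + (m + g) * D) ∈ S
    -- Passing from `i` to `i - g` does not raise the number of coins required; the spare ones are
    -- worthless.
    value (yes g≤i) = change⇒∈ (subst (Change b n _) amount
      (pad-coins (s≤s z≤n) (s≤s (*-monoˡ-≤ c (s≤s (m∸n≤m i g)))) (top∈ (≤-trans (m∸n≤m i g) i≤ν))))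
      where
      amount : a′ ∸ (i ∸ g) ≡ m + g
      amount = trans (cong (_∸ (i ∸ g)) (sym (m∸n+n≡m i≤a′)))
                     (trans (+-∸-assoc m (m∸n≤m i g)) (cong (_+_ m) (m∸[m∸n]≡n g≤i)))
    -- Units pay `e`: the exchange supplies `D` more coins, and `e ≤ g ≤ a ≤ D`.
    value (no g≰i) with e , i+e≡g ← m≤n⇒∃[o]m+o≡n (≰⇒> g≰i) =
      subst (_∈ S) (cong +_ amount) (change⇒∈ (pad-coins (s≤s z≤n) e≤ (unit-coins (s≤s (s≤s z≤n)))))
      where
      e≤ : e ≤ suc (suc i * c) + D
      e≤ = begin
        e                     ≤⟨ m≤n+m e (suc i) ⟩
        suc i + e             ≡⟨ i+e≡g ⟩
        g                     ≤⟨ geom-mono-≤ c (<⇒≤ (toℕ<n j)) ⟩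
        geom b n              ≡⟨ geom≡a ⟩
        a                     ≤⟨ a≤D ⟩
        D                     ≤⟨ m≤n+m D (suc (suc i * c)) ⟩
        suc (suc i * c) + D   ∎
        where open ≤-Reasoning
      amount : (suc (suc i * c) + D) * a + e * D ≡ suc (suc i * c) * a + (m + g) * D
      amount = overflow (suc (suc i * c)) D m i e (cong suc (m∸n+n≡m i≤a′)) i+e≡g

  -- Abstract because with-abstraction normalises its scrutinee, and unfolding this
  -- proof exhausts memory; for the same reason split is a separate function.
  abstract
    ∈S⊎f-∈S : ∀ x → x ∈ S ⊎ ∃[ i ] i ≤ ν × + f i - x ∈ S
    ∈S⊎f-∈S x = split (coprime-coefficients a⊥D x)
      where
      split : ∃[ k ] ∃[ m ] m < a × x ≡ k ℤ.* + a ℤ.+ + m ℤ.* + D → x ∈ S ⊎ ∃[ i ] i ≤ ν × + f i - x ∈ S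
      split (k , m , m<a , x≡)
        with i , l , l′ , m′ , i≤ν , sum-m , sum-l , ch , ch′
               ← complementary-change c ν m (subst (m <_) (sym geom≡a) m<a)
        with compare-pos k l
      -- The coefficient of `a` covers the greedy payment of `m`, with `e` copies of `a` to spare.
      ... | inj₁ (e , refl) =
        inj₁ (subst (_∈ S) (trans (pos-lin (e + l) a m D) (sym x≡))
                           (change⇒∈ (pad-coins (s≤s z≤n) (m≤n+m l e) ch)))
      -- The coefficient falls short, which leaves `f i - x` enough copies of `a` for the
      -- complementary payment.
      ... | inj₂ (e , refl) =
        inj₂ (i , i≤ν , subst (_∈ S) difference (change⇒∈ (pad-coins (s≤s z≤n) (m≤n+m l′ e) ch′)))
        where
        difference : + ((e + l′) * a + m′ * D) ≡ + f i - x
        difference = subtract-payment l l′ m m′ e a D sum-l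
          (trans (sym (m+n∸m≡n i (m + m′))) (cong (_∸ i) (suc-injective (trans sum-m geom≡a)))) x≡

  frobenius : IsFrobenius A (+ f 0)
  frobenius = f∉S z≤n , bound
    where
    bound : ∀ x → x ∉ S → x ℤ.≤ + f 0
    bound x x∉S with ∈S⊎f-∈S x
    ... | inj₁ x∈S = contradiction x∈S x∉S
    -- The combination `f i - x` is nonnegative, and `f i + i * d = f 0`.
    ... | inj₂ (i , i≤ν , cs , eq) = subst (x ℤ.≤_) f0≡ (ℤₚ.i≤i+j x (+ (dot cs A + i * d)))
      where
      restore : ∀ x y z → x ℤ.+ (y - x ℤ.+ z) ≡ y ℤ.+ z
      restore = ℤ-Solver.solve-∀
      f0≡ : x ℤ.+ + (dot cs A + i * d) ≡ + f 0
      f0≡ = trans (cong (λ z → x ℤ.+ (z ℤ.+ + (i * d))) (sym eq))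
           (trans (restore x (+ f i) (+ (i * d))) (cong +_ (f+i*d≡f0 i≤ν)))

  PF≐ : PF A ≐ λ u → ∃[ i ] i ≤ ν × u ≡ + f 0 - + (i * d)
  PF≐ = to , from
    where
    to : ∀ {u} → u ∈ PF A → ∃[ i ] i ≤ ν × u ≡ + f 0 - + (i * d)
    to {u} (u∉S , absorb) with ∈S⊎f-∈S u
    ... | inj₁ u∈S = contradiction u∈S u∉S
    ... | inj₂ (i , i≤ν , f-u∈S) with + f i - u ℤₚ.≟ ℤ.0ℤ
    ... | yes f-u≡0 = i , i≤ν , trans (sym (ℤₚ.i-j≡0⇒i≡j (+ f i) u f-u≡0)) (f≡f0-i*d i≤ν)
    -- Absorbing the nonzero element `f i - u` would put `f i` into the semigroup.
    ... | no f-u≢0 = contradiction (subst (_∈ S) (cancel u (+ f i)) (absorb (+ f i - u) f-u∈S f-u≢0)) (f∉S i≤ν)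
      where
      cancel : ∀ u y → u ℤ.+ (y - u) ≡ y
      cancel = ℤ-Solver.solve-∀
    from : ∀ {u} → ∃[ i ] i ≤ ν × u ≡ + f 0 - + (i * d) → u ∈ PF A
    from (i , i≤ν , refl) =
      subst (_∈ PF A) (f≡f0-i*d i≤ν) (PF-from-generators A (f∉S i≤ν) (f+generator∈S i≤ν))

  hasType : .{{NonZero d}} → HasType A (suc ν)
  hasType = map u (upTo (suc ν)) , Unique.map⁺ u-injective (Unique.upTo⁺ (suc ν))
       , trans (length-map u (upTo (suc ν))) (length-upTo (suc ν)) , to , from
    where
    u : ℕ → ℤ
    u i = + f 0 - + (i * d)
    u-injective : ∀ {i j} → u i ≡ u j → i ≡ j
    u-injective {i} {j} eq =
      *-cancelʳ-≡ i j d (ℤₚ.+-injective (ℤₚ.neg-injective (ℤ-Group.∙-cancelˡ (+ f 0) _ _ eq)))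
    to : ∀ {x} → x List.∈ map u (upTo (suc ν)) → x ∈ PF A
    to x∈ with i , i∈ , x≡ ← ∈-map⁻ u x∈ = proj₂ PF≐ (i , s≤s⁻¹ (∈-upTo⁻ i∈) , x≡)
    from : ∀ {x} → x ∈ PF A → x List.∈ map u (upTo (suc ν))
    from x∈ with i , i≤ν , refl ← proj₁ PF≐ x∈ = ∈-map⁺ u (∈-upTo⁺ (s≤s i≤ν))

theorem4p3 : (b n d : ℕ) .{{_ : NonTrivial b}} .{{_ : NonTrivial n}} .{{_ : NonZero d}} →
    gcd (repunit b n) d ≡ 1 →
    HasType (generators b n d) (n ∸ 1)
    × (∃[ F ] IsFrobenius (generators b n d) F
    × PF (generators b n d) ≐ (λ u → ∃[ i ] i ≤ n ∸ 2 × u ≡ F - + (i * d)))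
theorem4p3 (suc (suc γ)) (suc (suc ν)) d gcd≡1 = hasType , + f 0 , frobenius , PF≐
  where
  c = suc γ
  b = suc c
  r = geom b (2 + ν)

  -- Since `b ^ i = 1 + c * r_i`, the entry `b ^ i * a + r_i * d` equals `a + r_i * (c * a + d)`.
  generators≡ : generators b (2 + ν) d ≡ tabulate λ i → 1 * r + geom b (toℕ i) * (c * r + d)
  generators≡ = tabulate-cong λ i → trans
    (cong₂ _+_ (cong₂ _*_ (^≡1+pred*geom c (toℕ i)) (repunit≡geom γ (2 + ν)))
               (cong (_* d) (repunit≡geom γ (toℕ i))))
    (regroup c (geom b (toℕ i)) r d)
    where
    regroup : ∀ c g a d → suc (c * g) * a + g * d ≡ 1 * a + g * (c * a + d)
    regroup = solve-∀

  -- The choice of `a′` is one less than the repunit by the recursion of `geom`, hence `refl`.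
  open RepunitSemigroup γ ν d (b * geom b (suc ν)) refl
    (gcd≡1⇒coprime (subst (λ a → gcd a d ≡ 1) (repunit≡geom γ (2 + ν)) gcd≡1))
    (generators b (2 + ν) d) generators≡
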